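{- Let $s\ge2$ and let $G$ be a fixed $s$-uniform hypergraph of degeneracy $d\in\mathbb N$. Let $\omega=\omega(n)\to\infty$ as $n\to\infty$ and $t=n^{(d-1)/d}\omega$. Then in the semi-random hypergraph process with $r=1$ there exists a strategy $\mathcal S$ such that $$\lim_{n\to\infty}\mathbb P\big[H_t^{(1,s)}\text{ contains a sub-hypergraph isomorphic to } G\big]=1.$$
   Context: Semi-random hypergraph process with parameters $1\le r\le s$ on $[n]$: start with the empty hypergraph $H_0^{(r,s)}$ on $[n]$. In each step $t\ge1$ a set $U_t$ of $r$ vertices is chosen uniformly at random from $\binom{[n]}{r}$; the player, knowing the history and $U_t$, selects $s-r$ vertices $V_t$ (repetitions and overlap with $U_t$ allowed; the choice may be randomized according to a distribution depending on the history and $U_t$, and such a rule is a strategy $\mathcal S$), and the edge $U_t\cup V_t$ (as a multiset of size $s$) is added to form $H_t^{(r,s)}$; parallel edges are allowed. A hypergraph $G$ is $d$-degenerate if every sub-hypergraph $G'\subseteq G$ has minimum degree at most $d$; the degeneracy of $G$ is the smallest such $d$.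
   Formalization: The function ω(n) is taken to be rational-valued instead of real-valued, with t the integer part of n^{(d-1)/d}ω; a real ω can be replaced by a rational one giving the same integer part. -}

module Defs where

open import Data.Nat using (ℕ; zero; suc; _+_; _*_; _∸_; _^_; _≤_; _<_)
open import Data.Fin using (Fin)
open import Data.Fin.Subset using (Subset; _∈_; ∣_∣; Nonempty)
import Data.Fin.Subset as Sub
open import Data.Fin.Subset.Properties using (_∈?_)
open import Data.Vec using (Vec; _∷_; []; toList)
import Data.Vec.Membership.Propositional as VecMem
open import Data.List using (List; []; _∷_; _++_; [_]; length; filter; lookup)
open import Data.List.Relation.Unary.All using (All)
open import Data.List.Relation.Unary.Unique.Propositional using (Unique)
import Data.List.Relation.Binary.Sublist.Propositional as SubL
open import Data.Product using (Σ; ∃; ∃-syntax; _×_; _,_)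
open import Data.Integer using (ℤ; +_) renaming (∣_∣ to absℤ)
import Data.Integer as ℤ
open import Data.Rational using (ℚ; ↥_; ↧ₙ_) renaming (_≤_ to _≤ℚ_)
import Data.Rational as ℚ
open import Function.Definitions using (Injective)
open import Relation.Binary.PropositionalEquality using (_≡_)

record UniformHypergraph (m s : ℕ) : Set where
  field
    edges    : List (Subset m)
    distinct : Unique edges
    uniform  : All (λ e → ∣ e ∣ ≡ s) edges
open UniformHypergraph public

degIn : ∀ {m} → List (Subset m) → Fin m → ℕ
degIn F v = length (filter (v ∈?_) F)

IsDegenerate : ∀ {m s} → UniformHypergraph m s → ℕ → Set
IsDegenerate {m} G d =
  (W : Subset m) (F : List (Subset m)) →
  Nonempty W → F SubL.⊆ edges G → All (Sub._⊆ W) F →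
  ∃[ v ] (v ∈ W × degIn F v ≤ d)

Degeneracy : ∀ {m s} → UniformHypergraph m s → ℕ → Set
Degeneracy G d = IsDegenerate G d × (∀ d' → IsDegenerate G d' → d ≤ d')

-- Semi-random hypergraph process with r = 1 and s = suc k on Fin n.
-- Edges of H_t are multisets of size s, represented by vectors
-- (the first entry is the random vertex U_t, the rest is V_t).

Edge : ℕ → ℕ → Set
Edge n s = Vec (Fin n) s

-- A (deterministic) strategy: given the history (edges so far, in order)
-- and the random vertex u, choose the k = s - 1 vertices V_t.
Strategy : ℕ → ℕ → Set
Strategy n k = List (Edge n (suc k)) → Fin n → Vec (Fin n) k

runFrom : ∀ {n k} → Strategy n k → List (Edge n (suc k)) → List (Fin n) →
          List (Edge n (suc k))
runFrom S h []       = h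
runFrom S h (u ∷ us) = runFrom S (h ++ [ u ∷ S h u ]) us

run : ∀ {n k t} → Strategy n k → Vec (Fin n) t → List (Edge n (suc k))
run S us = runFrom S [] (toList us)

-- H contains a sub-hypergraph isomorphic to G:
-- an injective vertex map φ and an injective map ψ from edges of G to
-- edges of H (distinct edges, parallel copies count separately) such
-- that the multiset ψ(e) is exactly the set φ(e).

Matches : ∀ {m n s} → (Fin m → Fin n) → Subset m → Edge n s → Set
Matches {m} φ g h =
  (∀ v → v ∈ g → φ v VecMem.∈ h) ×
  (∀ x → x VecMem.∈ h → ∃[ v ] (v ∈ g × φ v ≡ x))

Contains : ∀ {m n s} → UniformHypergraph m s → List (Edge n s) → Set
Contains {m} {n} G H =
  Σ (Fin m → Fin n) λ φ → Injective _≡_ _≡_ φ ×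
  Σ (Fin (length (edges G)) → Fin (length H)) λ ψ → Injective _≡_ _≡_ ψ ×
  (∀ i → Matches φ (lookup (edges G) i) (lookup H (ψ i)))

TendsToInfinity : (ℕ → ℚ) → Set
TendsToInfinity ω = ∀ (M : ℕ) → ∃[ N ] (∀ n → N ≤ n → (+ M ℚ./ 1) ≤ℚ ω n)

-- T = ⌊ n^((d-1)/d) · q ⌋ for q > 0 (and T = 0 if q ≤ 0), i.e. with
-- q = a/b in lowest terms:  T^d b^d ≤ n^(d-1) a^d < (T+1)^d b^d.
IsFloorT : ℕ → ℕ → ℚ → ℕ → Set
IsFloorT d n q T =
  (ℚ.0ℚ ℚ.< q →
     (T ^ d * (↧ₙ q) ^ d ≤ n ^ (d ∸ 1) * absℤ (↥ q) ^ d) ×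
     (n ^ (d ∸ 1) * absℤ (↥ q) ^ d < (suc T) ^ d * (↧ₙ q) ^ d)) ×
  (q ≤ℚ ℚ.0ℚ → T ≡ 0)

-- P[ H_{T n} contains G ] → 1 as n → ∞, where the probability is over
-- uniformly random sequences (U_1,…,U_T) ∈ (Fin n)^T: for every j, for
-- all large n there are at least (1 - 1/(j+1)) n^T good sequences.
ProbTendsToOne : ∀ {m k} → UniformHypergraph m (suc k) → (T : ℕ → ℕ) →
                 ((n : ℕ) → Strategy n k) → Set
ProbTendsToOne G T S =
  ∀ (j : ℕ) → ∃[ N ] ∀ n → N ≤ n →
    ∃[ L ] (Unique L × All (λ (us : Vec (Fin n) (T n)) → Contains G (run (S n) us)) L
            × suc j * (n ^ T n ∸ length L) ≤ n ^ T n)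

{-# OPTIONS --safe #-}

-- Peeling off vertices of degree at most d orders the vertices of G so that each is the last
-- vertex of at most d edges. Reserve for each vertex v of G a class of c ≈ n / (m + 1)
-- possible images (which makes every embedding injective) and a phase of d blocks of τ steps. In
-- the j-th block of the phase of v the player always completes the random vertex by the
-- image of e ∖ v, where e is the j-th edge ending in v. The phase succeeds as soon as one vertex
-- of the class is drawn in each of the d blocks: it becomes the image of v. The number X of such
-- d-tuples of draws has mean c (τ/n)^d, and different vertices are negatively correlated,
-- so Chebyshev gives P[X = 0] ≤ (τ + n)^d / (c τ^d) → 0 when τ^d / n^(d-1) → ∞; a union bound
-- over the phases finishes the proof. Probabilities are counted, i.e. multiplied by n^t.
module Submission where

open import Defs
open import Data.Nat using (ℕ; zero; suc; _+_; _*_; _∸_; _^_; _≤_; _<_; z≤n; s≤s; s≤s⁻¹; NonZero; _≟_; _<?_; _/_; >-nonZero; >-nonZero⁻¹; ≢-nonZero; ≢-nonZero⁻¹)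
open import Data.Nat.Properties hiding (_≟_; _<?_)
open import Data.Nat.DivMod using (m≡m%n+[m/n]*n; m/n*n≤m; m%n<n; m*n/n≡m; /-monoˡ-≤)
open import Data.Nat.Tactic.RingSolver using (solve-∀)
open import Data.Integer using (+≤+; +<+) renaming (+_ to pos; ∣_∣ to absℤ)
import Data.Integer as ℤ
import Data.Integer.Properties as ℤₚ
open import Data.Rational using (ℚ; mkℚ; 0ℚ; ↥_; ↧ₙ_; *<*) renaming (_≤_ to _≤ℚ_; _<_ to _<ℚ_; _/_ to _/ℚ_)
import Data.Rational.Properties as ℚ
open import Data.Rational.Unnormalised using (mkℚᵘ; *≤*)
import Data.Rational.Unnormalised.Properties as ℚᵘ
open import Data.Fin using (Fin; zero; suc; combine; inject≤)
import Data.Fin.Properties as Fin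
open import Data.Fin.Subset using (Subset; inside; outside; _∈_; _∉_; ∣_∣; _-_; ⊤; ⊥; Nonempty)
import Data.Fin.Subset as Sub
open import Data.Fin.Subset.Properties using (x∈p∧x≢y⇒x∈p-y; x∈p⇒∣p-x∣<∣p∣; p─q⊆p; ⊆-antisym; ⊆-max; nonempty?; _∈?_; Empty-unique; ∣⊥∣≡0)
open import Data.List using (List; []; _∷_; _++_; [_]; length; map; take; drop; lookup; allFin; filter; cartesianProductWith)
open import Data.List.Properties using (length-tabulate; map-tabulate; take++drop≡id; length-take; length-drop; length-map; ++-assoc; ++-identityʳ; map-++; length-++-≤ˡ)
open import Data.List.Membership.Propositional using () renaming (_∈_ to _∈ˡ_)
open import Data.List.Membership.Propositional.Properties using (∈-map⁺; ∈-map⁻; ∈-++⁺ʳ; ∈-++⁺ˡ; ∈-∃++; ∈-lookup; ∈-filter⁺; ∈-filter⁻)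
open import Data.List.Relation.Unary.Any using (here; there; index)
open import Data.List.Relation.Unary.Any.Properties using (lookup-index)
import Data.List.Relation.Unary.All as All
open All using (All; []; _∷_)
open import Data.List.Relation.Unary.All.Properties using (all-filter; filter⁺)
open import Data.List.Relation.Unary.AllPairs using ([]; _∷_)
open import Data.List.Relation.Unary.Unique.Propositional using (Unique)
import Data.List.Relation.Unary.Unique.Propositional.Properties as Unique
import Data.List.Relation.Binary.Sublist.Propositional as SubL
import Data.List.Relation.Binary.Sublist.Propositional.Properties as SubL
open import Data.Vec using (Vec; []; _∷_; here; there; toList; replicate; head)
open import Data.Vec.Properties using (∷-injective; length-toList)
import Data.Vec.Membership.Propositional as VecMem
import Data.Vec.Relation.Unary.Any as VecAny
open import Data.Vec.Functional using (updateAt)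
open import Data.Vec.Functional.Properties using (updateAt-updates; updateAt-minimal)
open import Data.Product using (∃-syntax; ∃₂; _×_; _,_; proj₁; proj₂)
open import Data.Sum using (_⊎_; inj₁; inj₂; [_,_]′)
open import Function using (_∘_; id; const; it)
open import Function.Definitions using (Injective)
open import Relation.Nullary using (yes; no; ¬?; ¬_; contradiction)
open import Relation.Binary.PropositionalEquality hiding ([_])

private variable
  A A′ A″ : Set
  m n : ℕ

-- Sums over lists

∑ : List A → (A → ℕ) → ℕ
∑ []       f = 0
∑ (x ∷ xs) f = f x + ∑ xs f

∑-cong : ∀ (xs : List A) {f g : A → ℕ} → (∀ x → f x ≡ g x) → ∑ xs f ≡ ∑ xs g
∑-cong []       eq = refl
∑-cong (x ∷ xs) eq = cong₂ _+_ (eq x) (∑-cong xs eq)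

∑-mono : ∀ (xs : List A) {f g : A → ℕ} → (∀ x → f x ≤ g x) → ∑ xs f ≤ ∑ xs g
∑-mono []       le = z≤n
∑-mono (x ∷ xs) le = +-mono-≤ (le x) (∑-mono xs le)

∑-+ : ∀ (xs : List A) (f g : A → ℕ) → ∑ xs (λ x → f x + g x) ≡ ∑ xs f + ∑ xs g
∑-+ []       f g = refl
∑-+ (x ∷ xs) f g rewrite ∑-+ xs f g = interchange (f x) (g x) (∑ xs f) (∑ xs g)
  where
  interchange : ∀ a b c d → a + b + (c + d) ≡ a + c + (b + d)
  interchange = solve-∀

∑-*ˡ : ∀ (xs : List A) k (f : A → ℕ) → ∑ xs (λ x → k * f x) ≡ k * ∑ xs f
∑-*ˡ []       k f = sym (*-zeroʳ k)
∑-*ˡ (x ∷ xs) k f rewrite ∑-*ˡ xs k f = sym (*-distribˡ-+ k (f x) (∑ xs f))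

∑-*ʳ : ∀ (xs : List A) k (f : A → ℕ) → ∑ xs (λ x → f x * k) ≡ ∑ xs f * k
∑-*ʳ []       k f = refl
∑-*ʳ (x ∷ xs) k f rewrite ∑-*ʳ xs k f = sym (*-distribʳ-+ k (f x) (∑ xs f))

∑-const : ∀ (xs : List A) k → ∑ xs (λ _ → k) ≡ length xs * k
∑-const []       k = refl
∑-const (x ∷ xs) k = cong (k +_) (∑-const xs k)

∑-zero : ∀ (xs : List A) {f : A → ℕ} → (∀ x → f x ≡ 0) → ∑ xs f ≡ 0
∑-zero xs eq = trans (∑-cong xs eq) (trans (∑-const xs 0) (*-zeroʳ (length xs)))

∑-swap : ∀ (xs : List A) (ys : List A′) (f : A → A′ → ℕ) →
         ∑ xs (λ x → ∑ ys (f x)) ≡ ∑ ys (λ y → ∑ xs (λ x → f x y))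
∑-swap []       ys f = sym (∑-zero ys (λ _ → refl))
∑-swap (x ∷ xs) ys f rewrite ∑-swap xs ys f = sym (∑-+ ys (f x) _)

∑-product : ∀ (xs : List A) (ys : List A′) (f : A → ℕ) (g : A′ → ℕ) →
            ∑ xs f * ∑ ys g ≡ ∑ xs (λ x → ∑ ys (λ y → f x * g y))
∑-product xs ys f g = trans (sym (∑-*ʳ xs _ f)) (∑-cong xs (λ x → sym (∑-*ˡ ys (f x) g)))

∑-++ : ∀ (xs ys : List A) (f : A → ℕ) → ∑ (xs ++ ys) f ≡ ∑ xs f + ∑ ys f
∑-++ []       ys f = refl
∑-++ (x ∷ xs) ys f rewrite ∑-++ xs ys f = sym (+-assoc (f x) _ _)

∑-map : ∀ (h : A → A′) (xs : List A) (f : A′ → ℕ) → ∑ (map h xs) f ≡ ∑ xs (f ∘ h)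
∑-map h []       f = refl
∑-map h (x ∷ xs) f = cong (f (h x) +_) (∑-map h xs f)

∑-cartesianProductWith : ∀ (h : A → A′ → A″) xs ys (f : A″ → ℕ) →
  ∑ (cartesianProductWith h xs ys) f ≡ ∑ xs (λ x → ∑ ys (λ y → f (h x y)))
∑-cartesianProductWith h []       ys f = refl
∑-cartesianProductWith h (x ∷ xs) ys f
  rewrite ∑-++ (map (h x) ys) (cartesianProductWith h xs ys) f
        | ∑-map (h x) ys f
        | ∑-cartesianProductWith h xs ys f = refl

-- The Kronecker delta, with values in ℕ so that indicators can be multiplied and summed directly.
δ : ∀ {n} → Fin n → Fin n → ℕ
δ zero    zero    = 1
δ zero    (suc _) = 0
δ (suc _) zero    = 0
δ (suc v) (suc w) = δ v w

∑-allFin-suc : ∀ {n} (f : Fin (suc n) → ℕ) → ∑ (allFin (suc n)) f ≡ f zero + ∑ (allFin n) (f ∘ suc)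
∑-allFin-suc {n} f = cong (f zero +_) (trans (cong (λ l → ∑ l f) (sym (map-tabulate id suc))) (∑-map suc (allFin n) f))

∑-sift : ∀ {n} (v : Fin n) (f : Fin n → ℕ) → ∑ (allFin n) (λ x → δ v x * f x) ≡ f v
∑-sift {suc n} zero f rewrite ∑-allFin-suc (λ x → δ zero x * f x) | ∑-zero (allFin n) {λ _ → 0} (λ _ → refl)
  = trans (+-identityʳ _) (+-identityʳ _)
∑-sift {suc n} (suc v) f rewrite ∑-allFin-suc (λ x → δ (suc v) x * f x) = ∑-sift v (f ∘ suc)

∑-allFin-const : ∀ n k → ∑ (allFin n) (λ _ → k) ≡ n * k
∑-allFin-const n k = trans (∑-const (allFin n) k) (cong (_* k) (length-tabulate {n = n} id))

δ-sym : ∀ {n} (v w : Fin n) → δ v w ≡ δ w v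
δ-sym zero    zero    = refl
δ-sym zero    (suc _) = refl
δ-sym (suc _) zero    = refl
δ-sym (suc v) (suc w) = δ-sym v w

δ-refl : ∀ {n} (v : Fin n) → δ v v ≡ 1
δ-refl zero    = refl
δ-refl (suc v) = δ-refl v

δ≢0⇒≡ : ∀ {n} {v w : Fin n} → δ v w ≢ 0 → v ≡ w
δ≢0⇒≡ {v = zero}  {zero}  _  = refl
δ≢0⇒≡ {v = zero}  {suc _} ne with () ← ne refl
δ≢0⇒≡ {v = suc _} {zero}  ne with () ← ne refl
δ≢0⇒≡ {v = suc v} {suc w} ne = cong suc (δ≢0⇒≡ ne)

≢⇒δ≡0 : ∀ {n} {v w : Fin n} → v ≢ w → δ v w ≡ 0
≢⇒δ≡0 {v = zero}  {zero}  ne with () ← ne refl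
≢⇒δ≡0 {v = zero}  {suc _} ne = refl
≢⇒δ≡0 {v = suc _} {zero}  ne = refl
≢⇒δ≡0 {v = suc v} {suc w} ne = ≢⇒δ≡0 (ne ∘ cong suc)

-- Indicators, Chebyshev's inequality and powers

isZero : ℕ → ℕ
isZero zero    = 1
isZero (suc _) = 0

-- The square of the difference is nonnegative. Writing the larger number as the smaller plus k
-- makes this an identity with the summand k², free of truncated subtraction.
2xy≤x²+y² : ∀ x y → 2 * (x * y) ≤ x * x + y * y
2xy≤x²+y² x y with ≤-total x y
... | inj₁ le = subst (λ y → 2 * (x * y) ≤ x * x + y * y) (m+[n∸m]≡n le)
                      (≤-trans (m≤m+n _ _) (≤-reflexive (square x (y ∸ x))))
  where
  square : ∀ x k → 2 * (x * (x + k)) + k * k ≡ x * x + (x + k) * (x + k)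
  square = solve-∀
... | inj₂ le = subst (λ x → 2 * (x * y) ≤ x * x + y * y) (m+[n∸m]≡n le)
                      (≤-trans (m≤m+n _ _) (≤-reflexive (square y (x ∸ y))))
  where
  square : ∀ y k → 2 * ((y + k) * y) + k * k ≡ (y + k) * (y + k) + y * y
  square = solve-∀

-- The terms of Σ (Y − μ)² with Y = 0 contribute μ² each; (Y − μ)² is expanded to stay in ℕ.
chebyshev : ∀ (xs : List A) (Y : A → ℕ) μ V →
  ∑ xs Y ≡ length xs * μ →
  ∑ xs (λ x → Y x * Y x) ≤ length xs * (μ * μ + μ * V) →
  ∑ xs (isZero ∘ Y) * μ ≤ length xs * V
chebyshev xs Y zero V mean var = ≤-trans (≤-reflexive (*-zeroʳ (∑ xs (isZero ∘ Y)))) z≤n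
-- The cross term 2μ ∑ Y is kept on both sides until it cancels; then one factor μ cancels too, so μ
-- = 0 is a case of its own.
chebyshev xs Y μ@(suc _) V mean var = *-cancelˡ-≤ μ (+-cancelˡ-≤ (2 * (μ * (length xs * μ))) _ _ (begin
  2 * (μ * (N * μ)) + μ * (Z * μ)           ≡⟨ lhs μ N Z ⟩
  2 * μ * (N * μ) + Z * (μ * μ)             ≡⟨ cong (λ s → 2 * μ * s + Z * (μ * μ)) (sym mean) ⟩
  2 * μ * ∑ xs Y + Z * (μ * μ)              ≡⟨ cong₂ _+_ (sym (∑-*ˡ xs (2 * μ) Y)) (sym (∑-*ʳ xs (μ * μ) _)) ⟩
  _                                         ≡⟨ sym (∑-+ xs _ _) ⟩
  ∑ xs (λ x → 2 * μ * Y x + isZero (Y x) * (μ * μ))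
                                            ≤⟨ ∑-mono xs (λ x → pointwise (Y x)) ⟩
  ∑ xs (λ x → Y x * Y x + μ * μ)            ≡⟨ ∑-+ xs _ _ ⟩
  ∑ xs (λ x → Y x * Y x) + ∑ xs (λ _ → μ * μ)
                                            ≤⟨ +-mono-≤ var (≤-reflexive (∑-const xs (μ * μ))) ⟩
  N * (μ * μ + μ * V) + N * (μ * μ)         ≡⟨ rhs N μ V ⟩
  2 * (μ * (N * μ)) + μ * (N * V)           ∎))
  where
  open ≤-Reasoning
  N = length xs
  Z = ∑ xs (isZero ∘ Y)
  lhs : ∀ μ N Z → 2 * (μ * (N * μ)) + μ * (Z * μ) ≡ 2 * μ * (N * μ) + Z * (μ * μ)
  lhs = solve-∀
  rhs : ∀ N μ V → N * (μ * μ + μ * V) + N * (μ * μ) ≡ 2 * (μ * (N * μ)) + μ * (N * V)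
  rhs = solve-∀
  swap : ∀ μ y → 2 * μ * y + 0 ≡ 2 * (y * μ)
  swap = solve-∀
  pointwise : ∀ y → 2 * μ * y + isZero y * (μ * μ) ≤ y * y + μ * μ
  pointwise zero    = ≤-reflexive (trans (cong (_+ 1 * (μ * μ)) (*-zeroʳ (2 * μ))) (+-identityʳ (μ * μ)))
  pointwise (suc y) = ≤-trans (≤-reflexive (swap μ (suc y))) (2xy≤x²+y² (suc y) μ)

^-distribʳ-* : ∀ d m n → (m * n) ^ d ≡ m ^ d * n ^ d
^-distribʳ-* zero    m n = refl
^-distribʳ-* (suc d) m n rewrite ^-distribʳ-* d m n = interchange m n (m ^ d) (n ^ d)
  where
  interchange : ∀ a b c d → a * b * (c * d) ≡ a * c * (b * d)
  interchange = solve-∀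

-- Expectations over uniformly random words, multiplied by n ^ t

words : ∀ n t → List (Vec (Fin n) t)
words n zero    = [] ∷ []
words n (suc t) = cartesianProductWith _∷_ (allFin n) (words n t)

-- The integrand is a function on lists, so that `take` and `drop` cut a word without casts between
-- vector lengths.
E : ∀ {n} → ℕ → (List (Fin n) → ℕ) → ℕ
E {n} t f = ∑ (words n t) (f ∘ toList)

length-words : ∀ n t → length (words n t) ≡ n ^ t
length-words n zero    = refl
length-words n (suc t) = begin
  length (words n (suc t))             ≡⟨ sym (*-identityʳ _) ⟩
  length (words n (suc t)) * 1         ≡⟨ sym (∑-const (words n (suc t)) 1) ⟩
  ∑ (words n (suc t)) (λ _ → 1)        ≡⟨ ∑-cartesianProductWith _∷_ (allFin n) (words n t) _ ⟩
  ∑ (allFin n) (λ _ → ∑ (words n t) (λ _ → 1))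
    ≡⟨ ∑-allFin-const n _ ⟩
  n * ∑ (words n t) (λ _ → 1)
    ≡⟨ cong (n *_) (trans (∑-const (words n t) 1) (trans (*-identityʳ _) (length-words n t))) ⟩
  n * n ^ t                            ∎
  where open ≡-Reasoning

module _ {n : ℕ} where

  E-suc : ∀ t (f : List (Fin n) → ℕ) → E (suc t) f ≡ ∑ (allFin n) (λ x → E t (f ∘ (x ∷_)))
  E-suc t f = ∑-cartesianProductWith _∷_ (allFin n) (words n t) (f ∘ toList)

  E-const : ∀ t k → E {n} t (λ _ → k) ≡ n ^ t * k
  E-const t k = trans (∑-const (words n t) k) (cong (_* k) (length-words n t))

  -- Independence of the first s letters and the next t letters. With one of the two functions
  -- constantly 1 it also gives the marginals.
  E-split : ∀ s t (f g : List (Fin n) → ℕ) →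
            E (s + t) (λ us → f (take s us) * g (drop s us)) ≡ E s f * E t g
  E-split zero    t f g = trans (∑-*ˡ (words n t) (f []) _) (cong (_* E t g) (sym (+-identityʳ (f []))))
  E-split (suc s) t f g = begin
    E (suc s + t) (λ us → f (take (suc s) us) * g (drop (suc s) us)) ≡⟨ E-suc (s + t) (λ us → f (take (suc s) us) * g (drop (suc s) us)) ⟩
    _                           ≡⟨ ∑-cong (allFin n) (λ x → E-split s t (f ∘ (x ∷_)) g) ⟩
    ∑ (allFin n) (λ x → E s (f ∘ (x ∷_)) * E t g) ≡⟨ ∑-*ʳ (allFin n) _ _ ⟩
    _                           ≡⟨ cong (_* E t g) (sym (E-suc s f)) ⟩
    E (suc s) f * E t g         ∎
    where open ≡-Reasoning

  hits : Fin n → List (Fin n) → ℕ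
  hits v us = ∑ us (δ v)

  -- The mean t/n of a binomial count, cleared of denominators; the induction conditions on the
  -- first letter.
  E-hits : ∀ t v → n * E t (hits v) ≡ t * n ^ t
  E-hits zero    v = *-zeroʳ n
  E-hits (suc t) v = begin
    n * E (suc t) (hits v)
      ≡⟨ cong (n *_) (E-suc t (hits v)) ⟩
    n * ∑ (allFin n) (λ x → E t (λ us → δ v x + hits v us))
      ≡⟨ cong (n *_) (∑-cong (allFin n) (λ x → trans (∑-+ (words n t) _ _) (cong (_+ E t (hits v)) (trans (E-const t _) (*-comm (n ^ t) _))))) ⟩
    n * ∑ (allFin n) (λ x → δ v x * n ^ t + E t (hits v))
      ≡⟨ cong (n *_) (trans (∑-+ (allFin n) _ _) (cong₂ _+_ (∑-sift v _) (∑-allFin-const n _))) ⟩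
    n * (n ^ t + n * E t (hits v))
      ≡⟨ cong (λ z → n * (n ^ t + z)) (E-hits t v) ⟩
    n * (n ^ t + t * n ^ t)
      ≡⟨ arith n t (n ^ t) ⟩
    suc t * (n * n ^ t) ∎
    where
    open ≡-Reasoning
    arith : ∀ n t p → n * (p + t * p) ≡ (1 + t) * (n * p)
    arith = solve-∀

  -- The exact moment has t(t - 1) in place of t². For v ≠ w the hit counts are thus negatively
  -- correlated, and only the diagonal v = w adds the term t n.
  E-hits² : ∀ t v w → n * n * E t (λ us → hits v us * hits w us) ≤ n ^ t * (t * t + δ v w * (t * n))
  E-hits² zero    v w = ≤-trans (≤-reflexive (*-zeroʳ (n * n))) z≤n
  E-hits² (suc t) v w = begin
    n * n * E (suc t) (λ us → hits v us * hits w us)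
      ≡⟨ cong (n * n *_) (E-suc t (λ us → hits v us * hits w us)) ⟩
    n * n * ∑ (allFin n) (λ x → E t (λ us → (δ v x + hits v us) * (δ w x + hits w us)))
      ≡⟨ cong (n * n *_) (∑-cong (allFin n) inner) ⟩
    n * n * ∑ (allFin n) (λ x → δ v x * (δ w x * p + Q w) + (δ w x * Q v + R))
      ≡⟨ cong (n * n *_) (trans (∑-+ (allFin n) _ _) (cong₂ _+_ (∑-sift v _)
           (trans (∑-+ (allFin n) _ _) (cong₂ _+_ (∑-sift w _) (∑-allFin-const n R))))) ⟩
    n * n * ((δ w v * p + Q w) + (Q v + n * R))
      ≡⟨ arith₁ n (δ w v) p (Q w) (Q v) R ⟩
    n * n * (δ w v * p) + n * (n * Q w + n * Q v) + n * (n * n * R)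
      ≤⟨ +-mono-≤ (≤-reflexive (cong₂ (λ a b → n * n * (δ w v * p) + n * (a + b)) (E-hits t w) (E-hits t v)))
                  (*-monoʳ-≤ n (E-hits² t v w)) ⟩
    n * n * (δ w v * p) + n * (t * p + t * p) + n * (p * (t * t + δ v w * (t * n)))
      -- This slack supplies the 1 that completes t² + 2t to (1 + t)².
      ≤⟨ m≤m+n _ (n * p) ⟩
    n * n * (δ w v * p) + n * (t * p + t * p) + n * (p * (t * t + δ v w * (t * n))) + n * p
      ≡⟨ cong (λ e → n * n * (e * p) + n * (t * p + t * p) + n * (p * (t * t + δ v w * (t * n))) + n * p) (δ-sym w v) ⟩
    n * n * (δ v w * p) + n * (t * p + t * p) + n * (p * (t * t + δ v w * (t * n))) + n * p
      ≡⟨ arith₂ n (δ v w) p t ⟩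
    n * p * (suc t * suc t + δ v w * (suc t * n)) ∎
    where
    open ≤-Reasoning
    p = n ^ t
    Q = λ v → E t (hits v)
    R = E t (λ us → hits v us * hits w us)
    expand : ∀ a b c d → (a + c) * (b + d) ≡ a * b + a * d + (b * c + c * d)
    expand = solve-∀
    collect : ∀ a b p x y z → p * (a * b) + a * x + (b * y + z) ≡ a * (b * p + x) + (b * y + z)
    collect = solve-∀
    arith₁ : ∀ n e p x y r → n * n * ((e * p + x) + (y + n * r)) ≡ n * n * (e * p) + n * (n * x + n * y) + n * (n * n * r)
    arith₁ = solve-∀
    arith₂ : ∀ n e p t → n * n * (e * p) + n * (t * p + t * p) + n * (p * (t * t + e * (t * n))) + n * p
                         ≡ n * p * ((1 + t) * (1 + t) + e * ((1 + t) * n))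
    arith₂ = solve-∀
    inner : ∀ x → E t (λ us → (δ v x + hits v us) * (δ w x + hits w us)) ≡ δ v x * (δ w x * p + Q w) + (δ w x * Q v + R)
    inner x = trans (∑-cong (words n t) (λ us → expand (δ v x) (δ w x) _ _))
      (trans (∑-+ (words n t) _ _)
      (trans (cong₂ _+_ (trans (∑-+ (words n t) _ _) (cong₂ _+_ (E-const t _) (∑-*ˡ (words n t) (δ v x) _)))
                        (trans (∑-+ (words n t) _ _) (cong (_+ R) (∑-*ˡ (words n t) (δ w x) _))))
      (collect (δ v x) (δ w x) p (Q w) (Q v) R)))

-- Counting the words in which no vertex is hit in every block

-- With f = `hits x` this is the number of ways to choose one draw of x in each of d consecutive
-- blocks of length τ, hence nonzero exactly when every block contains x.
blocks : ∀ {n} → ℕ → ℕ → (List (Fin n) → ℕ) → List (Fin n) → ℕ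
blocks τ zero    f us = 1
blocks τ (suc d) f us = f (take τ us) * blocks τ d f (drop τ us)

copies : ∀ {n c} → ℕ → ℕ → (Fin c → Fin n) → List (Fin n) → ℕ
copies {c = c} τ d g us = ∑ (allFin c) (λ a → blocks τ d (hits (g a)) us)

module _ {n : ℕ} where

  E-blocks : ∀ τ d (f : List (Fin n) → ℕ) → E (d * τ) (blocks τ d f) ≡ E τ f ^ d
  E-blocks τ zero    f = refl
  E-blocks τ (suc d) f = trans (E-split τ (d * τ) f (blocks τ d f)) (cong (E τ f *_) (E-blocks τ d f))

  blocks-* : ∀ τ d (f g : List (Fin n) → ℕ) us →
             blocks τ d f us * blocks τ d g us ≡ blocks τ d (λ us → f us * g us) us
  blocks-* τ zero    f g us = refl
  blocks-* τ (suc d) f g us = trans (interchange (f (take τ us)) _ (g (take τ us)) _)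
    (cong (f (take τ us) * g (take τ us) *_) (blocks-* τ d f g (drop τ us)))
    where
    interchange : ∀ a b c d → a * b * (c * d) ≡ a * c * (b * d)
    interchange = solve-∀

isZero-≤-* : ∀ k m → isZero m ≤ isZero (k * m)
isZero-≤-* k zero    = ≤-reflexive (cong isZero (sym (*-zeroʳ k)))
isZero-≤-* k (suc m) = z≤n

-- P[no copy] ≤ Var / mean², and the variance only comes from the diagonal terms a = b.
copies-bound : ∀ {n c} τ d (g : Fin c → Fin n) → Injective _≡_ _≡_ g →
  E (d * τ) (isZero ∘ copies τ d g) * (c * τ ^ d) ≤ n ^ (d * τ) * (τ + n) ^ d
copies-bound {n} {c} τ d g inj = begin
  E (d * τ) (isZero ∘ X) * μ
    ≤⟨ *-monoˡ-≤ μ (∑-mono W (λ us → isZero-≤-* (n ^ d) (X (toList us)))) ⟩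
  ∑ W (isZero ∘ Y) * μ
    ≤⟨ chebyshev W Y μ V mean var ⟩
  length W * V
    ≡⟨ cong (_* V) (length-words n (d * τ)) ⟩
  n ^ (d * τ) * V ∎
  where
  open ≤-Reasoning
  W = words n (d * τ)
  X = copies τ d g
  -- Scaling X by n^d keeps zeros zero and turns the mean c (τ/n)^d into the natural number μ.
  Y : Vec (Fin n) (d * τ) → ℕ
  Y us = n ^ d * X (toList us)
  μ = c * τ ^ d
  V = (τ + n) ^ d
  N = n ^ (d * τ)
  F = allFin c
  h : Fin c → List (Fin n) → ℕ
  h a = hits (g a)

  N≡ : (n ^ τ) ^ d ≡ N
  N≡ = trans (^-*-assoc n τ d) (cong (n ^_) (*-comm τ d))

  first : ∀ a → n ^ d * E (d * τ) (blocks τ d (h a)) ≡ τ ^ d * N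
  first a = begin-equality
    n ^ d * E (d * τ) (blocks τ d (h a)) ≡⟨ cong (n ^ d *_) (E-blocks τ d (h a)) ⟩
    n ^ d * E τ (h a) ^ d                ≡⟨ sym (^-distribʳ-* d n _) ⟩
    (n * E τ (h a)) ^ d                  ≡⟨ cong (_^ d) (E-hits τ (g a)) ⟩
    (τ * n ^ τ) ^ d                      ≡⟨ ^-distribʳ-* d τ _ ⟩
    τ ^ d * (n ^ τ) ^ d                  ≡⟨ cong (τ ^ d *_) N≡ ⟩
    τ ^ d * N                            ∎

  mean : ∑ W Y ≡ length W * μ
  mean = begin-equality
    ∑ W Y
      ≡⟨ ∑-*ˡ W (n ^ d) _ ⟩
    n ^ d * ∑ W (X ∘ toList)
      ≡⟨ cong (n ^ d *_) (∑-swap W F _) ⟩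
    n ^ d * ∑ F (λ a → E (d * τ) (blocks τ d (h a)))
      ≡⟨ sym (∑-*ˡ F (n ^ d) _) ⟩
    ∑ F (λ a → n ^ d * E (d * τ) (blocks τ d (h a)))
      ≡⟨ ∑-cong F first ⟩
    ∑ F (λ _ → τ ^ d * N)
      ≡⟨ ∑-allFin-const c _ ⟩
    c * (τ ^ d * N)
      ≡⟨ arith c (τ ^ d) N ⟩
    N * μ
      ≡⟨ cong (_* μ) (sym (length-words n (d * τ))) ⟩
    length W * μ ∎
    where
    arith : ∀ c t p → c * (t * p) ≡ p * (c * t)
    arith = solve-∀

  -- Injectivity of g leaves the extra term only for a = b, where τ² + τn = τ(τ + n). The summand
  -- (τ²)^d is kept for all pairs: summed over a and b it gives μ², and the other one gives μ V.
  diagonal : ∀ a b → (τ * τ + δ (g a) (g b) * (τ * n)) ^ d ≤ (τ * τ) ^ d + δ a b * (τ * (τ + n)) ^ d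
  diagonal a b with a Fin.≟ b
  ... | yes refl rewrite δ-refl a | δ-refl (g a) | +-identityʳ (τ * n) | +-identityʳ ((τ * (τ + n)) ^ d)
                       | sym (*-distribˡ-+ τ τ n) = m≤n+m _ _
  ... | no a≢b rewrite ≢⇒δ≡0 (a≢b ∘ inj) | +-identityʳ (τ * τ) = m≤m+n _ _

  second : ∀ a b → n ^ d * n ^ d * E (d * τ) (λ us → blocks τ d (h a) us * blocks τ d (h b) us)
                   ≤ N * ((τ * τ) ^ d + δ a b * (τ * (τ + n)) ^ d)
  second a b = begin
    n ^ d * n ^ d * E (d * τ) (λ us → blocks τ d (h a) us * blocks τ d (h b) us)
      ≡⟨ cong (n ^ d * n ^ d *_) (∑-cong W (λ us → blocks-* τ d (h a) (h b) (toList us))) ⟩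
    n ^ d * n ^ d * E (d * τ) (blocks τ d (λ us → h a us * h b us))
      ≡⟨ cong₂ _*_ (sym (^-distribʳ-* d n n)) (E-blocks τ d _) ⟩
    (n * n) ^ d * E τ (λ us → h a us * h b us) ^ d
      ≡⟨ sym (^-distribʳ-* d (n * n) _) ⟩
    (n * n * E τ (λ us → h a us * h b us)) ^ d
      ≤⟨ ^-monoˡ-≤ d (E-hits² τ (g a) (g b)) ⟩
    (n ^ τ * (τ * τ + δ (g a) (g b) * (τ * n))) ^ d
      ≡⟨ trans (^-distribʳ-* d (n ^ τ) _) (cong (_* (τ * τ + δ (g a) (g b) * (τ * n)) ^ d) N≡) ⟩
    N * (τ * τ + δ (g a) (g b) * (τ * n)) ^ d
      ≤⟨ *-monoʳ-≤ N (diagonal a b) ⟩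
    N * ((τ * τ) ^ d + δ a b * (τ * (τ + n)) ^ d) ∎

  var : ∑ W (λ us → Y us * Y us) ≤ length W * (μ * μ + μ * V)
  var = begin
    ∑ W (λ us → Y us * Y us)
      ≡⟨ ∑-cong W (λ us → trans (interchange (n ^ d) (X (toList us))) (cong (n ^ d * n ^ d *_) (∑-product F F _ _))) ⟩
    ∑ W (λ us → n ^ d * n ^ d * ∑ F (λ a → ∑ F (λ b → blocks τ d (h a) (toList us) * blocks τ d (h b) (toList us))))
      ≡⟨ ∑-*ˡ W (n ^ d * n ^ d) _ ⟩
    n ^ d * n ^ d * ∑ W (λ us → ∑ F (λ a → ∑ F (λ b → blocks τ d (h a) (toList us) * blocks τ d (h b) (toList us))))
      ≡⟨ cong (n ^ d * n ^ d *_) (trans (∑-swap W F _) (∑-cong F (λ a → ∑-swap W F _))) ⟩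
    n ^ d * n ^ d * ∑ F (λ a → ∑ F (λ b → E (d * τ) (λ us → blocks τ d (h a) us * blocks τ d (h b) us)))
      ≡⟨ sym (trans (∑-cong F (λ a → ∑-*ˡ F (n ^ d * n ^ d) _)) (∑-*ˡ F (n ^ d * n ^ d) _)) ⟩
    ∑ F (λ a → ∑ F (λ b → n ^ d * n ^ d * E (d * τ) (λ us → blocks τ d (h a) us * blocks τ d (h b) us)))
      ≤⟨ ∑-mono F (λ a → ∑-mono F (second a)) ⟩
    ∑ F (λ a → ∑ F (λ b → N * ((τ * τ) ^ d + δ a b * (τ * (τ + n)) ^ d)))
      ≡⟨ ∑-cong F (λ a → trans (∑-*ˡ F N _) (cong (N *_) (trans (∑-+ F _ _) (cong₂ _+_ (∑-allFin-const c _) (∑-sift a _))))) ⟩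
    ∑ F (λ a → N * (c * (τ * τ) ^ d + (τ * (τ + n)) ^ d))
      ≡⟨ ∑-allFin-const c _ ⟩
    c * (N * (c * (τ * τ) ^ d + (τ * (τ + n)) ^ d))
      ≡⟨ cong₂ (λ x y → c * (N * (c * x + y))) (^-distribʳ-* d τ τ) (^-distribʳ-* d τ (τ + n)) ⟩
    c * (N * (c * (τ ^ d * τ ^ d) + τ ^ d * V))
      ≡⟨ arith c N (τ ^ d) V ⟩
    N * (μ * μ + μ * V)
      ≡⟨ cong (_* (μ * μ + μ * V)) (sym (length-words n (d * τ))) ⟩
    length W * (μ * μ + μ * V) ∎
    where
    interchange : ∀ a b → a * b * (a * b) ≡ a * a * (b * b)
    interchange = solve-∀
    arith : ∀ c p t v → c * (p * (c * (t * t) + t * v)) ≡ p * (c * t * (c * t) + c * t * v)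
    arith = solve-∀

-- Union bound over the phases

failures : ∀ {A : Set} {n c} → ℕ → ℕ → (A → Fin c → Fin n) → List A → List (Fin n) → ℕ
failures τ d g []       us = 0
failures τ d g (p ∷ ps) us = isZero (copies τ d (g p) (take (d * τ) us)) + failures τ d g ps (drop (d * τ) us)

-- Linearity of expectation: each phase reads its own stretch of d τ letters and fails with
-- probability at most 1/R. Letters after the last phase are free, so t may exceed the total length
-- of the phases.
failures-bound : ∀ {A : Set} {n c} τ d R (g : A → Fin c → Fin n) →
  (∀ p → R * E (d * τ) (isZero ∘ copies τ d (g p)) ≤ n ^ (d * τ)) →
  ∀ ps t → length ps * (d * τ) ≤ t → R * E t (failures τ d g ps) ≤ length ps * n ^ t
failures-bound τ d R g bound []       t le = ≤-reflexive (trans (cong (R *_) (∑-zero (words _ t) (λ _ → refl))) (*-zeroʳ R))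
failures-bound {n = n} τ d R g bound (p ∷ ps) t le = begin
  R * E t f                               ≡⟨ cong (λ t → R * E t f) (sym t≡) ⟩
  R * E (s + r) f                         ≡⟨ cong (R *_) (∑-+ (words n (s + r)) _ _) ⟩
  R * (E (s + r) (z ∘ take s) + E (s + r) (f′ ∘ drop s))
    ≡⟨ cong (R *_) (cong₂ _+_
         (trans (∑-cong (words n (s + r)) (λ us → sym (*-identityʳ _))) (E-split s r z (λ _ → 1)))
         (trans (∑-cong (words n (s + r)) (λ us → sym (+-identityʳ _))) (E-split s r (λ _ → 1) f′))) ⟩
  R * (E s z * E {n} r (λ _ → 1) + E {n} s (λ _ → 1) * E r f′)
    ≡⟨ cong₂ (λ x y → R * (E s z * x + y * E r f′)) (total r) (total s) ⟩
  R * (E s z * n ^ r + n ^ s * E r f′)    ≡⟨ arith₁ R (E s z) (n ^ r) (n ^ s) (E r f′) ⟩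
  R * E s z * n ^ r + n ^ s * (R * E r f′)
    ≤⟨ +-mono-≤ (*-monoˡ-≤ (n ^ r) (bound p)) (*-monoʳ-≤ (n ^ s) (failures-bound τ d R g bound ps r le′)) ⟩
  n ^ s * n ^ r + n ^ s * (length ps * n ^ r) ≡⟨ arith₂ (n ^ s) (n ^ r) (length ps) ⟩
  suc (length ps) * (n ^ s * n ^ r)       ≡⟨ cong (suc (length ps) *_) (trans (sym (^-distribˡ-+-* n s r)) (cong (n ^_) t≡)) ⟩
  suc (length ps) * n ^ t                 ∎
  where
  open ≤-Reasoning
  s = d * τ
  r = t ∸ s
  f = failures τ d g (p ∷ ps)
  z = isZero ∘ copies τ d (g p)
  f′ = failures τ d g ps
  t≡ : s + r ≡ t
  t≡ = m+[n∸m]≡n (m+n≤o⇒m≤o s le)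
  le′ : length ps * s ≤ r
  le′ = m+n≤o⇒m≤o∸n (length ps * s) (≤-trans (≤-reflexive (+-comm (length ps * s) s)) le)
  total : ∀ t → E {n} t (λ _ → 1) ≡ n ^ t
  total t = trans (E-const t 1) (*-identityʳ (n ^ t))
  arith₁ : ∀ R z x y w → R * (z * x + y * w) ≡ R * z * x + y * (R * w)
  arith₁ = solve-∀
  arith₂ : ∀ x y l → x * y + x * (l * y) ≡ (1 + l) * (x * y)
  arith₂ = solve-∀

-- Markov's inequality at level 1: each point outside the zero set contributes at least 1 to the
-- sum.
length≤zeros+∑ : ∀ {A : Set} (f : A → ℕ) xs → length xs ≤ length (filter (λ x → f x ≟ 0) xs) + ∑ xs f
length≤zeros+∑ f []       = z≤n
length≤zeros+∑ f (x ∷ xs) with f x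
... | zero  = s≤s (length≤zeros+∑ f xs)
... | suc k = ≤-trans (s≤s (≤-trans (length≤zeros+∑ f xs) (+-monoʳ-≤ (length (filter (λ x → f x ≟ 0) xs)) (m≤n+m (∑ xs f) k)))) (≤-reflexive (sym (+-suc (length (filter (λ x → f x ≟ 0) xs)) (k + ∑ xs f))))

successful : ∀ {A : Set} {n c} → ℕ → ℕ → (A → Fin c → Fin n) → List A → ∀ t → List (Vec (Fin n) t)
successful {n = n} τ d g ps t = filter (λ us → failures τ d g ps (toList us) ≟ 0) (words n t)

few-unsuccessful : ∀ {A : Set} {n c} .{{_ : NonZero n}} τ d j (g : A → Fin c → Fin n) → (∀ p → Injective _≡_ _≡_ (g p)) →
  ∀ ps t → length ps * (d * τ) ≤ t → suc j * suc (length ps) * (τ + n) ^ d ≤ c * τ ^ d →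
  suc j * (n ^ t ∸ length (successful τ d g ps t)) ≤ n ^ t
few-unsuccessful {n = n} {c} {{nz}} τ d j g inj ps t le large = begin
  suc j * (n ^ t ∸ length L)              ≤⟨ *-monoʳ-≤ (suc j) (m≤n+o⇒m∸n≤o (n ^ t) (length L) (subst (_≤ length L + F) (length-words n t) (length≤zeros+∑ _ (words n t)))) ⟩
  suc j * F                               ≤⟨ *-cancelˡ-≤ (suc P) (begin
      suc P * (suc j * F)                   ≡⟨ arith (suc P) (suc j) F ⟩
      R * F                                 ≤⟨ failures-bound τ d R g bound ps t le ⟩
      P * n ^ t                             ≤⟨ *-monoˡ-≤ (n ^ t) (n≤1+n P) ⟩
      suc P * n ^ t                         ∎) ⟩
  n ^ t                                   ∎
  where
  open ≤-Reasoning
  P = length ps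
  L = successful τ d g ps t
  F = E t (failures τ d g ps)
  -- P failure probabilities of at most 1/R add up to at most 1/(j + 1). The factor P + 1 replaces P
  -- because it must be cancelled even when there are no phases.
  R = suc j * suc P
  instance
    nz′ : NonZero ((τ + n) ^ d)
    nz′ = m^n≢0 (τ + n) d {{≢-nonZero λ eq → ≢-nonZero⁻¹ n {{nz}} (m+n≡0⇒n≡0 τ eq)}}
  arith : ∀ p j f → p * (j * f) ≡ j * p * f
  arith = solve-∀
  arith′ : ∀ r z v → r * z * v ≡ z * (r * v)
  arith′ = solve-∀
  bound : ∀ p → R * E (d * τ) (isZero ∘ copies τ d (g p)) ≤ n ^ (d * τ)
  bound p = *-cancelʳ-≤ _ _ ((τ + n) ^ d) (begin
    R * B * (τ + n) ^ d         ≡⟨ arith′ R B _ ⟩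
    B * (R * (τ + n) ^ d)       ≤⟨ *-monoʳ-≤ B large ⟩
    B * (c * τ ^ d)             ≤⟨ copies-bound τ d (g p) (inj p) ⟩
    n ^ (d * τ) * (τ + n) ^ d   ∎)
    where B = E (d * τ) (isZero ∘ copies τ d (g p))

-- The strategy

elements : Subset m → List (Fin m)
elements []            = []
elements (outside ∷ p) = map suc (elements p)
elements (inside  ∷ p) = zero ∷ map suc (elements p)

length-elements : (p : Subset m) → length (elements p) ≡ ∣ p ∣
length-elements []            = refl
length-elements (outside ∷ p) = trans (length-map suc (elements p)) (length-elements p)
length-elements (inside  ∷ p) = cong suc (trans (length-map suc (elements p)) (length-elements p))

∈-elements⁺ : {p : Subset m} {x : Fin m} → x ∈ p → x ∈ˡ elements p
∈-elements⁺ here                      = here refl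
∈-elements⁺ {p = outside ∷ p} (there x∈p) = ∈-map⁺ suc (∈-elements⁺ x∈p)
∈-elements⁺ {p = inside  ∷ p} (there x∈p) = there (∈-map⁺ suc (∈-elements⁺ x∈p))

∈-elements⁻ : {p : Subset m} {x : Fin m} → x ∈ˡ elements p → x ∈ p
∈-elements⁻ {p = outside ∷ p} x∈ with _ , y∈ , refl ← ∈-map⁻ suc x∈ = there (∈-elements⁻ y∈)
∈-elements⁻ {p = inside ∷ p} (here refl) = here
∈-elements⁻ {p = inside ∷ p} (there x∈) with _ , y∈ , refl ← ∈-map⁻ suc x∈ = there (∈-elements⁻ y∈)

x∉p-x : (p : Subset m) (x : Fin m) → x ∉ p - x
x∉p-x (outside ∷ p) zero    ()
x∉p-x (inside  ∷ p) zero    ()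
x∉p-x (outside ∷ p) (suc x) (there x∈) = x∉p-x p x x∈
x∉p-x (inside  ∷ p) (suc x) (there x∈) = x∉p-x p x x∈

-- Filling up with the random vertex u adds nothing to the support of an edge that contains u
-- anyway.
padded : ∀ k → A → List A → Vec A k
padded zero    u xs       = []
padded (suc k) u []       = u ∷ padded k u []
padded (suc k) u (x ∷ xs) = x ∷ padded k u xs

∈-padded⁺ : ∀ {k} {u y : A} {xs} → length xs ≤ k → y ∈ˡ xs → y VecMem.∈ padded k u xs
∈-padded⁺ (s≤s le) (here eq)  = VecAny.here eq
∈-padded⁺ (s≤s le) (there y∈) = VecAny.there (∈-padded⁺ le y∈)

∈-padded⁻ : ∀ k {u y : A} xs → y VecMem.∈ padded k u xs → y ≡ u ⊎ y ∈ˡ xs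
∈-padded⁻ (suc k) []       (VecAny.here eq)  = inj₁ eq
∈-padded⁻ (suc k) []       (VecAny.there y∈) = ∈-padded⁻ k [] y∈
∈-padded⁻ (suc k) (x ∷ xs) (VecAny.here eq)  = inj₂ (here eq)
∈-padded⁻ (suc k) (x ∷ xs) (VecAny.there y∈) with ∈-padded⁻ k xs y∈
... | inj₁ eq  = inj₁ eq
... | inj₂ y∈′ = inj₂ (there y∈′)

take-++-exact : ∀ {ℓ} (xs ys : List A) → length xs ≡ ℓ → take ℓ (xs ++ ys) ≡ xs
take-++-exact []       ys refl = refl
take-++-exact (x ∷ xs) ys refl = cong (x ∷_) (take-++-exact xs ys refl)

drop-++-exact : ∀ {ℓ} (xs ys : List A) → length xs ≡ ℓ → drop ℓ (xs ++ ys) ≡ ys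
drop-++-exact []       ys refl = refl
drop-++-exact (x ∷ xs) ys refl = drop-++-exact xs ys refl

length-take-≤ : ∀ {ℓ} {xs : List A} → ℓ ≤ length xs → length (take ℓ xs) ≡ ℓ
length-take-≤ {ℓ = ℓ} {xs} le = trans (length-take ℓ xs) (m≤n⇒m⊓n≡m le)

length-prefix-< : ∀ (xs ys zs : List A) {y} → zs ≡ xs ++ y ∷ ys → length xs < length zs
length-prefix-< []       ys _ refl = s≤s z≤n
length-prefix-< (x ∷ xs) ys _ refl = s≤s (length-prefix-< xs ys _ refl)

++≮ : ∀ {ℓ} (xs ys : List A) → length xs ≡ ℓ → ¬ (length (xs ++ ys) < ℓ)
++≮ xs ys refl lt = <⇒≱ lt (length-++-≤ˡ xs)

hit-position : ∀ {x : Fin n} us → hits x us ≢ 0 → x ∈ˡ us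
hit-position []       ne = contradiction refl ne
hit-position {x = x} (u ∷ us) ne with δ x u in eq
... | zero  = there (hit-position us ne)
... | suc k = here (δ≢0⇒≡ λ eq′ → contradiction (trans (sym eq) eq′) λ ())

-- Phases and schedules

Phase : ℕ → Set
Phase m = Fin m × List (Subset m)

-- The edges of a phase are those to be completed by the random choice of its vertex;
-- all their other vertices are placed in earlier phases.
record Completes (d k : ℕ) (p : Phase m) (later : List (Phase m)) : Set where
  field
    few    : length (proj₂ p) ≤ d
    on     : ∀ {e} → e ∈ˡ proj₂ p → proj₁ p ∈ e
    size   : ∀ {e} → e ∈ˡ proj₂ p → ∣ e ∣ ≤ suc k
    before : ∀ {e} → e ∈ˡ proj₂ p → All (λ q → proj₁ q ∉ e) later
open Completes

data Schedule {m} (d k : ℕ) : List (Phase m) → Set where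
  []  : Schedule d k []
  _∷_ : ∀ {p ps} → Completes d k p ps → Schedule d k ps → Schedule d k (p ∷ ps)

-- The rule of the player, and why it serves every scheduled edge when no phase fails

module Player {m n c : ℕ} (emb : Fin m → Fin (suc c) → Fin n) (τ d k : ℕ) where

  winner : Fin m → List (Fin n) → Fin (suc c)
  winner v us with Fin.any? (λ a → ¬? (blocks τ d (hits (emb v a)) us ≟ 0))
  ... | yes (a , _) = a
  -- An arbitrary candidate for a failed phase; `served` assumes that no phase fails.
  ... | no _        = zero

  winner-hit : ∀ v us → isZero (copies τ d (emb v) us) ≡ 0 → blocks τ d (hits (emb v (winner v us))) us ≢ 0
  winner-hit v us some with Fin.any? (λ a → ¬? (blocks τ d (hits (emb v a)) us ≟ 0))
  ... | yes (a , ne) = ne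
  ... | no none      = contradiction (trans (sym (cong isZero (∑-zero (allFin (suc c)) empty))) some) λ ()
    where
    empty : ∀ a → blocks τ d (hits (emb v a)) us ≡ 0
    empty a with blocks τ d (hits (emb v a)) us ≟ 0
    ... | yes eq = eq
    ... | no ne  = contradiction (a , ne) none

  -- The edge under construction after the draws `us` of the current phase, one edge per block. Once
  -- the edges of the phase are used up, the value ⊥ marks its remaining blocks as idle.
  target : List (Subset m) → List (Fin n) → Subset m
  target []       us = ⊥
  target (e ∷ es) us with length us <? τ
  ... | yes _ = e
  ... | no  _ = target es (drop τ us)

  target-now : ∀ {e es us} → length us < τ → target (e ∷ es) us ≡ e
  target-now {us = us} lt with length us <? τ
  ... | yes _ = refl
  ... | no ge = contradiction lt ge

  target-later : ∀ {e es} bs us → length bs ≡ τ → target (e ∷ es) (bs ++ us) ≡ target es us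
  target-later {es = es} bs us len with length (bs ++ us) <? τ
  ... | yes lt = contradiction lt (++≮ bs us len)
  ... | no _   = cong (target es) (drop-++-exact bs us len)

  -- The block reserved for e contains a draw of x. The target is evaluated at the prefix `ys`
  -- strictly before that draw, which is what the player has seen of the phase when answering it.
  target-hit : ∀ b {es us x e} → length es ≤ b → b * τ ≤ length us → blocks τ b (hits x) us ≢ 0 → e ∈ˡ es →
               ∃₂ λ ys zs → us ≡ ys ++ x ∷ zs × target es ys ≡ e
  target-hit (suc b) {e ∷ es} {us} {x} (s≤s few) long hit (here refl)
    with ys , zs , eq ← ∈-∃++ (hit-position (take τ us) λ eq → hit (cong (_* blocks τ b (hits x) (drop τ us)) eq))
    = ys , zs ++ drop τ us
    , trans (sym (take++drop≡id τ us)) (trans (cong (_++ drop τ us) eq) (++-assoc ys (x ∷ zs) _))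
    , target-now {e} {es} (subst (length ys <_) (length-take-≤ (m+n≤o⇒m≤o τ long)) (length-prefix-< ys zs _ eq))
  target-hit (suc b) {e ∷ es} {us} {x} (s≤s few) long hit (there e∈)
    with ys , zs , eq , tgt ← target-hit b few
           (subst (b * τ ≤_) (sym (length-drop τ us)) (m+n≤o⇒m≤o∸n (b * τ) (≤-trans (≤-reflexive (+-comm (b * τ) τ)) long)))
           (λ eq → hit (trans (cong (hits x (take τ us) *_) eq) (*-zeroʳ (hits x (take τ us))))) e∈
    = take τ us ++ ys , zs
    , trans (sym (take++drop≡id τ us)) (trans (cong (take τ us ++_) eq) (sym (++-assoc (take τ us) ys _)))
    , trans (target-later {e} {es} (take τ us) ys (length-take-≤ (m+n≤o⇒m≤o τ long))) tgt

  -- Only an index inside the class of each vertex is stored: with disjoint classes `place α` is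
  -- injective for every α.
  Placement : Set
  Placement = Fin m → Fin (suc c)

  place : Placement → Fin m → Fin n
  place α v = emb v (α v)

  settle : Placement → Fin m → List (Fin n) → Placement
  settle α v us = updateAt α v (const (winner v us))

  -- The state is recomputed from all draws: completed phases are consumed one by one and update α.
  -- During its own phase v has no image yet, so it is removed from the target and the random vertex
  -- stands in for it.
  response : List (Phase m) → Placement → List (Fin n) → Fin n → Vec (Fin n) k
  response []             α us u = replicate k u
  response ((v , es) ∷ ps) α us u with length us <? d * τ
  ... | yes _ = padded k u (map (place α) (elements (target es us - v)))
  ... | no  _ = response ps (settle α v (take (d * τ) us)) (drop (d * τ) us) u

  response-now : ∀ {v es ps α us u} → length us < d * τ →
    response ((v , es) ∷ ps) α us u ≡ padded k u (map (place α) (elements (target es us - v)))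
  response-now {us = us} lt with length us <? d * τ
  ... | yes _ = refl
  ... | no ge = contradiction lt ge

  response-later : ∀ {v es ps α} bs us {u} → length bs ≡ d * τ →
    response ((v , es) ∷ ps) α (bs ++ us) u ≡ response ps (settle α v bs) us u
  response-later {v} {es} {ps} {α} bs us {u} len with length (bs ++ us) <? d * τ
  ... | yes lt = contradiction lt (++≮ bs us len)
  ... | no _   = cong₂ (λ b u′ → response ps (settle α v b) u′ u) (take-++-exact bs us len) (drop-++-exact bs us len)

  final : List (Phase m) → Placement → List (Fin n) → Placement
  final []             α us = α
  final ((v , _) ∷ ps) α us = final ps (settle α v (take (d * τ) us)) (drop (d * τ) us)

  final-stable : ∀ ps {α us w} → All (λ q → proj₁ q ≢ w) ps → final ps α us w ≡ α w
  final-stable []             []         = refl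
  final-stable ((v , _) ∷ ps) {α} {us} {w} (v≢w ∷ rest) =
    trans (final-stable ps rest) (updateAt-minimal w v α (v≢w ∘ sym))

  private
    avoid : ∀ {ps : List (Phase m)} {e w} → w ∈ e → All (λ q → proj₁ q ∉ e) ps → All (λ q → proj₁ q ≢ w) ps
    avoid w∈e []         = []
    avoid w∈e (∉e ∷ rest) = (λ { refl → ∉e w∈e }) ∷ avoid w∈e rest

  -- The answer was computed from α, before v was settled. On e - v this already agrees with the
  -- final placement, since neither the phase of v nor any later phase moves these vertices; the
  -- drawn vertex is the final image of v.
  settled-matches : ∀ {v e ps α} bs us → v ∈ e → ∣ e ∣ ≤ suc k → All (λ q → proj₁ q ∉ e) ps →
    Matches (place (final ps (settle α v bs) us)) e
            (emb v (winner v bs) ∷ padded k (emb v (winner v bs)) (map (place α) (elements (e - v))))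
  settled-matches {v} {e} {ps} {α} bs us v∈e size before = to , from
    where
    φ = place (final ps (settle α v bs) us)
    x = emb v (winner v bs)
    others = map (place α) (elements (e - v))
    φ-v : φ v ≡ x
    φ-v = cong (emb v) (trans (final-stable ps (avoid v∈e before)) (updateAt-updates v α))
    φ-other : ∀ {w} → w ∈ e → w ≢ v → φ w ≡ place α w
    φ-other {w} w∈e w≢v = cong (emb w) (trans (final-stable ps (avoid w∈e before)) (updateAt-minimal w v α w≢v))
    short : length others ≤ k
    short = ≤-trans (≤-reflexive (trans (length-map (place α) (elements (e - v))) (length-elements (e - v))))
                    (s≤s⁻¹ (≤-trans (x∈p⇒∣p-x∣<∣p∣ v∈e) size))
    to : ∀ w → w ∈ e → φ w VecMem.∈ (x ∷ padded k x others)
    to w w∈e with w Fin.≟ v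
    ... | yes refl = VecAny.here φ-v
    ... | no w≢v   = VecAny.there (subst (VecMem._∈ padded k x others) (sym (φ-other w∈e w≢v))
                       (∈-padded⁺ short (∈-map⁺ (place α) (∈-elements⁺ (x∈p∧x≢y⇒x∈p-y w∈e w≢v)))))
    from : ∀ y → y VecMem.∈ (x ∷ padded k x others) → ∃[ w ] (w ∈ e × φ w ≡ y)
    from y (VecAny.here refl) = v , v∈e , φ-v
    from y (VecAny.there y∈) with ∈-padded⁻ k others y∈
    ... | inj₁ refl = v , v∈e , φ-v
    ... | inj₂ y∈others with w , w∈ , refl ← ∈-map⁻ (place α) y∈others =
      w , w∈e , φ-other w∈e (λ { refl → x∉p-x e w (∈-elements⁻ w∈) })
      where w∈e = p─q⊆p e _ (∈-elements⁻ w∈)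

  -- The winner is known only at the end of its phase, but every draw in a block is answered as if
  -- it were to become the image of v. Hence a candidate drawn in all d blocks has had all edges of
  -- the phase completed by then.
  served : ∀ ps α us → Schedule d k ps → length ps * (d * τ) ≤ length us → failures τ d (emb ∘ proj₁) ps us ≡ 0 →
    ∀ {p e} → p ∈ˡ ps → e ∈ˡ proj₂ p →
    ∃[ ys ] ∃[ x ] ∃[ zs ] (us ≡ ys ++ x ∷ zs × Matches (place (final ps α us)) e (x ∷ response ps α ys x))
  served ((v , es) ∷ ps) α us (ok ∷ _) long succ {e = e} (here refl) e∈ =
    let (ys , zs , eq , tgt) = target-hit d (few ok) (≤-reflexive (sym bs-length))
                                 (winner-hit v bs (m+n≡0⇒m≡0 _ succ)) e∈
        now = response-now {v} {es} {ps} {α} {ys} {x} (subst (length ys <_) bs-length (length-prefix-< ys zs bs eq))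
    in ys , x , zs ++ drop L us
     , trans (sym (take++drop≡id L us)) (trans (cong (_++ drop L us) eq) (++-assoc ys (x ∷ zs) _))
     , subst (λ r → Matches φ e (x ∷ r)) (sym (trans now (cong (λ t → padded k x (map (place α) (elements (t - v)))) tgt)))
         (settled-matches {v} {e} {ps} {α} bs (drop L us) (on ok e∈) (size ok e∈) (before ok e∈))
    where
    L = d * τ
    bs = take L us
    x = emb v (winner v bs)
    φ = place (final ps (settle α v bs) (drop L us))
    bs-length : length bs ≡ L
    bs-length = length-take-≤ (m+n≤o⇒m≤o L long)
  served ((v , es) ∷ ps) α us (ok ∷ sched) long succ {e = e} (there p∈) e∈ =
    let (ys , x , zs , eq , match) = served ps (settle α v bs) (drop L us) sched long′
                                       (m+n≡0⇒n≡0 (isZero (copies τ d (emb v) bs)) succ) p∈ e∈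
    in bs ++ ys , x , zs
     , trans (sym (take++drop≡id L us)) (trans (cong (bs ++_) eq) (sym (++-assoc bs ys _)))
     , subst (λ r → Matches φ e (x ∷ r)) (sym (response-later {v} {es} {ps} {α} bs ys (length-take-≤ (m+n≤o⇒m≤o L long)))) match
    where
    L = d * τ
    bs = take L us
    φ = place (final ps (settle α v bs) (drop L us))
    long′ : length ps * L ≤ length (drop L us)
    long′ = subst (length ps * L ≤_) (sym (length-drop L us))
              (m+n≤o⇒m≤o∸n (length ps * L) (≤-trans (≤-reflexive (+-comm (length ps * L) L)) long))

  -- The head of each edge is its random vertex, so the history reveals all earlier draws.
  strategy : List (Phase m) → Strategy n k
  strategy ps H u = response ps (λ _ → zero) (map head H) u

-- Edges that occur in a run

module _ {n k : ℕ} (S : Strategy n k) (R : List (Fin n) → Fin n → Vec (Fin n) k) (S≡ : ∀ H u → S H u ≡ R (map head H) u) where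

  run-⊇ : ∀ {H h} us → h ∈ˡ H → h ∈ˡ runFrom S H us
  run-⊇         []       h∈ = h∈
  run-⊇ {H = H} (u ∷ us) h∈ = run-⊇ us (∈-++⁺ˡ h∈)

  -- Edges are never removed, so it suffices to follow the run up to the draw x. The induction moves
  -- the letters of `ys` one at a time into the heads of the history H.
  run-edge : ∀ H ys x zs → x ∷ R (map head H ++ ys) x ∈ˡ runFrom S H (ys ++ x ∷ zs)
  run-edge H [] x zs = run-⊇ zs (∈-++⁺ʳ H (here (cong (x ∷_)
    (trans (cong (λ us → R us x) (++-identityʳ (map head H))) (sym (S≡ H x))))))
  run-edge H (y ∷ ys) x zs = subst (λ us → x ∷ R us x ∈ˡ runFrom S (H ++ [ y ∷ S H y ]) (ys ++ x ∷ zs))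
    (trans (cong (_++ ys) (map-++ head H [ y ∷ S H y ])) (++-assoc (map head H) [ y ] ys))
    (run-edge (H ++ [ y ∷ S H y ]) ys x zs)

-- From matched edges to a copy of G

lookup-injective : ∀ {xs : List A} → Unique xs → ∀ i j → lookup xs i ≡ lookup xs j → i ≡ j
lookup-injective (_ ∷ _)      zero    zero    eq = refl
lookup-injective (x∉ ∷ _)     zero    (suc j) eq = contradiction eq (All.lookup x∉ (∈-lookup j))
lookup-injective (x∉ ∷ _)     (suc i) zero    eq = contradiction (sym eq) (All.lookup x∉ (∈-lookup i))
lookup-injective (_ ∷ unique) (suc i) (suc j) eq = cong suc (lookup-injective unique i j eq)

module _ {m n s : ℕ} {φ : Fin m → Fin n} (inj : Injective _≡_ _≡_ φ) where

  matches-⊆ : ∀ {e f} {h : Edge n s} → Matches φ e h → Matches φ f h → ∀ {v} → v ∈ e → v ∈ f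
  matches-⊆ (to , _) (_ , from) {v} v∈e with w , w∈f , eq ← from (φ v) (to v v∈e) = subst (_∈ _) (inj eq) w∈f

  -- An edge of H matches at most one edge of G, which makes ψ injective.
  contains : (G : UniformHypergraph m s) {H : List (Edge n s)} →
             (∀ {e} → e ∈ˡ edges G → ∃[ h ] (h ∈ˡ H × Matches φ e h)) → Contains G H
  contains G {H} match = φ , inj , ψ , ψ-injective , ψ-matches
    where
    image = λ i → match (∈-lookup {xs = edges G} i)
    ψ : Fin (length (edges G)) → Fin (length H)
    ψ i = index (proj₁ (proj₂ (image i)))
    ψ-matches : ∀ i → Matches φ (lookup (edges G) i) (lookup H (ψ i))
    ψ-matches i = subst (Matches φ _) (lookup-index (proj₁ (proj₂ (image i)))) (proj₂ (proj₂ (image i)))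
    ψ-injective : Injective _≡_ _≡_ ψ
    ψ-injective {i} {j} eq = lookup-injective (distinct G) i j
      (⊆-antisym (matches-⊆ (ψ-matches i) match-j) (matches-⊆ match-j (ψ-matches i)))
      where match-j = subst (λ p → Matches φ (lookup (edges G) j) (lookup H p)) (sym eq) (ψ-matches j)

-- A schedule from degeneracy

Covers : ∀ {m} → List (Phase m) → Subset m → Set
Covers ps e = ∃[ p ] (p ∈ˡ ps × e ∈ˡ proj₂ p)

module _ {m k : ℕ} (G : UniformHypergraph m (suc k)) {d : ℕ} (degenerate : IsDegenerate G d) where

  -- A peeled vertex goes in front of those peeled before it.
  peel : ∀ size W F ps → ∣ W ∣ ≤ size → F SubL.⊆ edges G → All (Sub._⊆ W) F → Schedule d k ps →
         All (λ q → All (proj₁ q ∉_) F) ps →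
         ∃[ qs ] (Schedule d k qs × (∀ {e} → e ∈ˡ F ⊎ Covers ps e → Covers qs e))
  peel size W F ps small F⊆ within sched fresh with nonempty? W
  -- Edges of F lie inside W and have k + 1 > 0 vertices, so an empty W leaves no edge to cover.
  ... | no empty = ps , sched , λ { (inj₁ e∈) → contradiction (edge-in-W e∈) empty ; (inj₂ covers) → covers }
    where
    edge-in-W : ∀ {e} → e ∈ˡ F → Nonempty W
    edge-in-W {e} e∈ with nonempty? e
    ... | yes (x , x∈e) = x , All.lookup within e∈ x∈e
    ... | no none = contradiction (trans (sym (All.lookup (uniform G) (SubL.lookup F⊆ e∈)))
                      (trans (cong ∣_∣ (Empty-unique none)) (∣⊥∣≡0 m))) λ ()
  peel zero W F ps small F⊆ within sched fresh | yes (x , x∈W) =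
    contradiction (≤-trans (x∈p⇒∣p-x∣<∣p∣ x∈W) small) λ ()
  peel (suc size) W F ps small F⊆ within sched fresh | yes nonempty =
    let (v , v∈W , deg) = degenerate W F nonempty F⊆ within
        -- The remaining edges through v form its phase. The vertices peeled before v come later in
        -- the schedule, and by `fresh` they lie on no remaining edge; the edges in F′ avoid v,
        -- which keeps `fresh` true.
        Fᵥ = filter (v ∈?_) F
        F′ = filter (¬? ∘ (v ∈?_)) F
        completes = record
          { few    = deg
          ; on     = λ e∈ → proj₂ (∈-filter⁻ (v ∈?_) {xs = F} e∈)
          ; size   = λ e∈ → ≤-reflexive (All.lookup (uniform G) (SubL.lookup F⊆ (proj₁ (∈-filter⁻ (v ∈?_) {xs = F} e∈))))
          ; before = λ e∈ → All.map (λ new → All.lookup new (proj₁ (∈-filter⁻ (v ∈?_) {xs = F} e∈))) fresh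
          }
        within′ = All.tabulate λ e∈ {w} w∈e → let (e∈F , v∉e) = ∈-filter⁻ (¬? ∘ (v ∈?_)) {xs = F} e∈ in
                    x∈p∧x≢y⇒x∈p-y (All.lookup within e∈F w∈e) λ { refl → v∉e w∈e }
        (qs , sched′ , covers) = peel size (W - v) F′ ((v , Fᵥ) ∷ ps)
          (s≤s⁻¹ (≤-trans (x∈p⇒∣p-x∣<∣p∣ v∈W) small))
          (SubL.⊆-trans (SubL.filter-⊆ (¬? ∘ (v ∈?_)) F) F⊆)
          within′
          (completes ∷ sched)
          (all-filter (¬? ∘ (v ∈?_)) F ∷ All.map (filter⁺ (¬? ∘ (v ∈?_))) fresh)
    in qs , sched′ , λ
      { (inj₁ e∈) → covers (split v _ e∈)
      ; (inj₂ (p , p∈ , e∈)) → covers (inj₂ (p , there p∈ , e∈)) }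
    where
    split : ∀ v e → e ∈ˡ F → e ∈ˡ filter (¬? ∘ (v ∈?_)) F ⊎ Covers ((v , filter (v ∈?_) F) ∷ ps) e
    split v e e∈ with v ∈? e
    ... | yes v∈e = inj₂ (_ , here refl , ∈-filter⁺ (v ∈?_) e∈ v∈e)
    ... | no v∉e  = inj₁ (∈-filter⁺ (¬? ∘ (v ∈?_)) e∈ v∉e)

  schedule : ∃[ ps ] (Schedule d k ps × (∀ {e} → e ∈ˡ edges G → Covers ps e))
  schedule =
    let (ps , sched , covers) = peel ∣ ⊤ {n = m} ∣ ⊤ (edges G) [] ≤-refl SubL.⊆-refl
                                  (All.tabulate λ _ → ⊆-max _) [] []
    in ps , sched , covers ∘ inj₁

-- Disjoint classes of candidates; successful words yield G

words-unique : ∀ n t → Unique (words n t)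
words-unique n zero    = [] ∷ []
words-unique n (suc t) = Unique.cartesianProductWith⁺ _∷_ ∷-injective (Unique.allFin⁺ n) (words-unique n t)

module _ {m n : ℕ} where

  cell : ∀ {c} → m * c ≤ n → Fin m → Fin c → Fin n
  cell fits v a = inject≤ (combine v a) fits

  cell-injective : ∀ {c} (fits : m * c ≤ n) {v w} {a b : Fin c} → cell fits v a ≡ cell fits w b → v ≡ w × a ≡ b
  cell-injective fits {v} {w} {a} {b} eq = Fin.combine-injective v a w b (Fin.inject≤-injective fits fits _ _ eq)

  playerStrategy : ∀ {k} c → m * c ≤ n → ℕ → ℕ → List (Phase m) → Strategy n k
  -- Without candidates any answer will do; the class size n / (m + 1) chosen later vanishes only
  -- for n ≤ m.
  playerStrategy zero    fits τ d ps = λ H u → replicate _ u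
  playerStrategy (suc c) fits τ d ps = Player.strategy (cell fits) τ d _ ps

  success : ∀ {k d} (G : UniformHypergraph m (suc k)) {ps} → Schedule d k ps → (∀ {e} → e ∈ˡ edges G → Covers ps e) →
    ∀ c .{{_ : NonZero c}} (fits : m * c ≤ n) τ t (us : Vec (Fin n) t) → length ps * (d * τ) ≤ t →
    failures τ d (cell fits ∘ proj₁) ps (toList us) ≡ 0 → Contains G (run (playerStrategy {k} c fits τ d ps) us)
  success {k} {d} G {ps} sched covers (suc c) fits τ t us long succ = contains injective G edge
    where
    open Player (cell fits) τ d k
    α = final ps (λ _ → zero) (toList us)
    injective : Injective _≡_ _≡_ (place α)
    injective eq = proj₁ (cell-injective fits eq)
    edge : ∀ {e} → e ∈ˡ edges G → ∃[ h ] (h ∈ˡ run (strategy ps) us × Matches (place α) e h)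
    edge e∈ =
      let (p , p∈ , e∈p) = covers e∈
          (ys , x , zs , eq , match) = served ps (λ _ → zero) (toList us) sched
             (subst (length ps * (d * τ) ≤_) (sym (length-toList us)) long) succ p∈ e∈p
          h = x ∷ response ps (λ _ → zero) ys x
      in h , subst (λ l → h ∈ˡ runFrom (strategy ps) [] l) (sym eq)
               (run-edge (strategy ps) (response ps (λ _ → zero)) (λ _ _ → refl) [] ys x zs)
           , match

-- Arithmetic of the parameters

-- The larger of τ and n dominates τ + n up to a factor 2. If it is τ, the lower bound on c
-- suffices; if it is n, one factor n is at most 2Qc and the remaining n^d is absorbed by the growth
-- of τ^(d+1).
threshold : ∀ n c τ t d R B Q .{{_ : NonZero n}} .{{_ : NonZero R}} .{{_ : NonZero B}} .{{_ : NonZero Q}} →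
  R * 2 ^ suc d ≤ c → n ≤ 2 * (Q * c) → suc t ≤ B * suc τ →
  n ^ d * (B * (2 * (R * 2 ^ suc d * (2 * Q)))) ^ suc d < suc t ^ suc d →
  R * (τ + n) ^ suc d ≤ c * τ ^ suc d
threshold n c τ t d R B Q c-large n≤ t≤ t-large = [ n≤τ-case , τ≤n-case ]′ (≤-total n τ)
  where
  open ≤-Reasoning
  D = suc d
  K = R * 2 ^ D * (2 * Q)
  instance
    K≢0 : NonZero K
    K≢0 = m*n≢0 (R * 2 ^ D) (2 * Q) {{m*n≢0 R (2 ^ D) {{it}} {{m^n≢0 2 D}}}} {{m*n≢0 2 Q}}
  swap : ∀ x y z → x * (y * z) ≡ y * (x * z)
  swap = solve-∀
  bound₁ : n ^ d * (2 * K) ^ D < suc τ ^ D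
  bound₁ = *-cancelˡ-< (B ^ D) _ _ (begin-strict
    B ^ D * (n ^ d * (2 * K) ^ D)   ≡⟨ swap (B ^ D) (n ^ d) _ ⟩
    n ^ d * (B ^ D * (2 * K) ^ D)   ≡⟨ cong (n ^ d *_) (sym (^-distribʳ-* D B (2 * K))) ⟩
    n ^ d * (B * (2 * K)) ^ D       <⟨ t-large ⟩
    suc t ^ D                       ≤⟨ ^-monoˡ-≤ D t≤ ⟩
    (B * suc τ) ^ D                 ≡⟨ ^-distribʳ-* D B (suc τ) ⟩
    B ^ D * suc τ ^ D               ∎)
  -- For τ = 0, `bound₁` would put a positive integer strictly below 1.
  τ>0 : 0 < τ
  τ>0 = s≤s⁻¹ (≰⇒> λ τ≤1 → <⇒≱ bound₁ (begin
    suc τ ^ D                       ≤⟨ ^-monoˡ-≤ D τ≤1 ⟩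
    1 ^ D                           ≡⟨ ^-zeroˡ D ⟩
    1                               ≤⟨ *-mono-≤ (m^n>0 n d) (m^n>0 (2 * K) {{m*n≢0 2 K}} D) ⟩
    n ^ d * (2 * K) ^ D             ∎))
  -- The 2 in 2K pays for τ + 1 ≤ 2τ, and K ≤ K^D since K ≥ 1.
  bound₂ : n ^ d * K ≤ τ ^ D
  bound₂ = *-cancelˡ-≤ (2 ^ D) {{m^n≢0 2 D}} (begin
    2 ^ D * (n ^ d * K)             ≤⟨ *-monoʳ-≤ (2 ^ D) (*-monoʳ-≤ (n ^ d) (m≤m*n K (K ^ d) {{m^n≢0 K d}})) ⟩
    2 ^ D * (n ^ d * K ^ D)         ≡⟨ swap (2 ^ D) (n ^ d) _ ⟩
    n ^ d * (2 ^ D * K ^ D)         ≡⟨ cong (n ^ d *_) (sym (^-distribʳ-* D 2 K)) ⟩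
    n ^ d * (2 * K) ^ D             <⟨ bound₁ ⟩
    suc τ ^ D                       ≤⟨ ^-monoˡ-≤ D (≤-trans (+-monoˡ-≤ τ τ>0) (≤-reflexive (cong (τ +_) (sym (+-identityʳ τ))))) ⟩
    (2 * τ) ^ D                     ≡⟨ ^-distribʳ-* D 2 τ ⟩
    2 ^ D * τ ^ D                   ∎)
  double : ∀ {x y} → x ≤ y → (x + y) ^ D ≤ 2 ^ D * y ^ D
  double {x} {y} le = ≤-trans (^-monoˡ-≤ D (+-mono-≤ le (≤-reflexive (sym (+-identityʳ y))))) (≤-reflexive (^-distribʳ-* D 2 y))
  n≤τ-case : n ≤ τ → R * (τ + n) ^ D ≤ c * τ ^ D
  n≤τ-case le = begin
    R * (τ + n) ^ D                 ≡⟨ cong (λ s → R * s ^ D) (+-comm τ n) ⟩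
    R * (n + τ) ^ D                 ≤⟨ *-monoʳ-≤ R (double le) ⟩
    R * (2 ^ D * τ ^ D)             ≡⟨ sym (*-assoc R (2 ^ D) (τ ^ D)) ⟩
    R * 2 ^ D * τ ^ D               ≤⟨ *-monoˡ-≤ (τ ^ D) c-large ⟩
    c * τ ^ D                       ∎
  τ≤n-case : τ ≤ n → R * (τ + n) ^ D ≤ c * τ ^ D
  τ≤n-case le = begin
    R * (τ + n) ^ D                 ≤⟨ *-monoʳ-≤ R (double le) ⟩
    R * (2 ^ D * (n * n ^ d))       ≤⟨ *-monoʳ-≤ R (*-monoʳ-≤ (2 ^ D) (*-monoˡ-≤ (n ^ d) n≤)) ⟩
    R * (2 ^ D * (2 * (Q * c) * n ^ d)) ≡⟨ arith R (2 ^ D) Q c (n ^ d) ⟩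
    c * (n ^ d * K)                 ≤⟨ *-monoʳ-≤ c bound₂ ⟩
    c * τ ^ D                       ∎
    where
    arith : ∀ r p q c x → r * (p * (2 * (q * c) * x)) ≡ c * (x * (r * p * (2 * q)))
    arith = solve-∀

≤ℚ⇒ratio : ∀ M .{{_ : NonZero M}} q → pos M /ℚ 1 ≤ℚ q → 0ℚ <ℚ q × M * ↧ₙ q ≤ absℤ (↥ q)
≤ℚ⇒ratio M q@(mkℚ num b-1 _) le
  with *≤* le′ ← ℚᵘ.≤-respˡ-≃ (ℚ.toℚᵘ-fromℚᵘ (mkℚᵘ (pos M) 0)) (ℚ.toℚᵘ-mono-≤ le)
  with subst₂ ℤ._≤_ (sym (ℤₚ.pos-* M (suc b-1))) (ℤₚ.*-identityʳ num) le′
... | +≤+ {n = a} Mb≤a = *<* (subst (pos 0 ℤ.<_) (sym (ℤₚ.*-identityʳ (pos a)))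
        (+<+ (≤-trans (>-nonZero⁻¹ (M * suc b-1) {{m*n≢0 M (suc b-1)}}) Mb≤a))) , Mb≤a

-- The floor satisfies t + 1 > n^(d/(d+1)) q with q ≥ M; this is raised to the power d + 1 and
-- cleared of the denominator of q.
floor-large : ∀ M .{{_ : NonZero M}} d n q t → pos M /ℚ 1 ≤ℚ q → IsFloorT (suc d) n q t → n ^ d * M ^ suc d < suc t ^ suc d
floor-large M d n q t le (positive , _) with 0<q , ratio ← ≤ℚ⇒ratio M q le = *-cancelʳ-< (↧ₙ q ^ D) _ _ (begin-strict
  n ^ d * M ^ D * ↧ₙ q ^ D          ≡⟨ *-assoc (n ^ d) (M ^ D) _ ⟩
  n ^ d * (M ^ D * ↧ₙ q ^ D)        ≡⟨ cong (n ^ d *_) (sym (^-distribʳ-* D M (↧ₙ q))) ⟩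
  n ^ d * (M * ↧ₙ q) ^ D            ≤⟨ *-monoʳ-≤ (n ^ d) (^-monoˡ-≤ D ratio) ⟩
  n ^ d * absℤ (↥ q) ^ D            <⟨ proj₂ (positive 0<q) ⟩
  suc t ^ D * ↧ₙ q ^ D              ∎)
  where
  open ≤-Reasoning
  D = suc d

m<n*suc[m/n] : ∀ m n .{{_ : NonZero n}} → m < n * suc (m / n)
m<n*suc[m/n] m n = subst₂ _<_ (sym (m≡m%n+[m/n]*n m n)) (*-comm (suc (m / n)) n) (+-monoˡ-< (m / n * n) (m%n<n m n))

theorem1p4 : (k : ℕ) → 1 ≤ k → (m : ℕ) (G : UniformHypergraph m (suc k)) →
    (d : ℕ) → Degeneracy G d → 1 ≤ d →
    (ω : ℕ → ℚ) → TendsToInfinity ω →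
    (T : ℕ → ℕ) → (∀ n → IsFloorT d n (ω n) (T n)) →
    ∃[ S ] ProbTendsToOne G T S
theorem1p4 k _ m G (suc d) (degenerate , _) _ ω ω→∞ T floor = S , tends
  where
  D = suc d
  -- The divisors m + 1 and (P + 1) D, instead of m and P D, are positive even for an empty vertex
  -- set or an empty schedule; rounding down still leaves room for all classes and all phases.
  Q = suc m
  plan = schedule G degenerate
  ps = proj₁ plan
  sched = proj₁ (proj₂ plan)
  covers = proj₂ (proj₂ plan)
  P = length ps
  B = suc P * D
  τ : ℕ → ℕ
  τ n = T n / B
  c : ℕ → ℕ
  c n = n / Q
  fits : ∀ n → m * c n ≤ n
  fits n = ≤-trans (*-monoˡ-≤ (c n) (n≤1+n m)) (≤-trans (≤-reflexive (*-comm Q (c n))) (m/n*n≤m n Q))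
  S : ∀ n → Strategy n k
  S n = playerStrategy (c n) (fits n) (τ n) D ps
  tends : ProbTendsToOne G T S
  -- The sum serves as an upper bound of two thresholds: the first gives ω(n) ≥ M, the second gives
  -- class size at least C.
  tends j = proj₁ (ω→∞ M) + C * Q , λ n N≤n →
    let
      instance
        n≢0 : NonZero n
        n≢0 = >-nonZero (≤-trans (>-nonZero⁻¹ (C * Q) {{m*n≢0 C Q {{C≢0}}}}) (m+n≤o⇒n≤o (proj₁ (ω→∞ M)) N≤n))
      C≤c = C≤c′ n (m+n≤o⇒n≤o (proj₁ (ω→∞ M)) N≤n)
      c≢0 = >-nonZero (≤-trans (>-nonZero⁻¹ C {{C≢0}}) C≤c)
    in successful (τ n) D (cell (fits n) ∘ proj₁) ps (T n)
     , Unique.filter⁺ _ (words-unique n (T n))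
     , All.map (λ {us} → success G sched covers (c n) {{c≢0}} (fits n) (τ n) (T n) us (long n)) (all-filter _ (words n (T n)))
     , few-unsuccessful (τ n) D j (cell (fits n) ∘ proj₁) (λ p eq → proj₂ (cell-injective {m = m} (fits n) eq)) ps (T n) (long n)
         (threshold n (c n) (τ n) (T n) d R B Q {{n≢0}} C≤c (n≤2Qc n c≢0) (m<n*suc[m/n] (T n) B)
           (floor-large M {{M≢0}} d n (ω n) (T n) (proj₂ (ω→∞ M) n (m+n≤o⇒m≤o (proj₁ (ω→∞ M)) N≤n)) (floor n)))
    where
    R = suc j * suc P
    C = R * 2 ^ D
    -- The factor whose power appears in the last hypothesis of `threshold`; it depends on j and G
    -- but not on n.
    M = B * (2 * (C * (2 * Q)))
    C≢0 : NonZero C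
    C≢0 = m*n≢0 R (2 ^ D) {{it}} {{m^n≢0 2 D}}
    M≢0 : NonZero M
    M≢0 = m*n≢0 B _ {{it}} {{m*n≢0 2 _ {{it}} {{m*n≢0 C (2 * Q) {{C≢0}}}}}}
    C≤c′ : ∀ n → C * Q ≤ n → C ≤ c n
    C≤c′ n le = subst (_≤ c n) (m*n/n≡m C Q) (/-monoˡ-≤ Q le)
    long : ∀ n → P * (D * τ n) ≤ T n
    long n = begin
      P * (D * τ n)     ≡⟨ sym (*-assoc P D (τ n)) ⟩
      P * D * τ n       ≤⟨ *-monoˡ-≤ (τ n) (*-monoˡ-≤ D (n≤1+n P)) ⟩
      B * τ n           ≡⟨ *-comm B (τ n) ⟩
      τ n * B           ≤⟨ m/n*n≤m (T n) B ⟩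
      T n               ∎
      where open ≤-Reasoning
    -- Rounding n / Q down costs at most a factor 2 once the quotient is at least 1.
    n≤2Qc : ∀ n → NonZero (c n) → n ≤ 2 * (Q * c n)
    n≤2Qc n c≢0 = begin
      n                 ≤⟨ <⇒≤ (m<n*suc[m/n] n Q) ⟩
      Q * suc (c n)     ≤⟨ *-monoʳ-≤ Q (+-monoˡ-≤ (c n) (>-nonZero⁻¹ (c n) {{c≢0}})) ⟩
      Q * (c n + c n)   ≡⟨ arith Q (c n) ⟩
      2 * (Q * c n)     ∎
      where
      open ≤-Reasoning
      arith : ∀ q c → q * (c + c) ≡ 2 * (q * c)
      arith = solve-∀
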